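{- Let $m\geq t\geq 3$ be integers with $t$ even. Then there exists a signed magic array $SMA(m,2m;2t,t)$.
   Context: For positive integers $m,n,s,t$, a signed magic array $SMA(m,n;s,t)$ is an $m\times n$ array ($m$ rows, $n$ columns), some of whose cells may be empty, with entries from the set $X$, where $X=\{0,\pm1,\pm2,\ldots,\pm (ms-1)/2\}$ if $ms$ is odd and $X=\{\pm1,\pm2,\ldots,\pm ms/2\}$ if $ms$ is even, such that precisely $s$ cells in every row and precisely $t$ cells in every column are filled, every integer in $X$ appears exactly once in the array, and the sum of each row and of each column is zero. -}

module Defs where

open import Data.Nat.Base as ℕ using (ℕ; _≤_; _∸_; _/_)
open import Data.Nat.Divisibility using (_∣_)
open import Data.Integer.Base using (ℤ; 0ℤ) renaming (∣_∣ to abs)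
open import Data.Integer.Properties using (+-0-commutativeMonoid)
open import Algebra.Properties.CommutativeMonoid.Sum +-0-commutativeMonoid using (sum)
open import Data.Fin.Base using (Fin)
open import Data.Fin.Subset using (Subset; ∣_∣)
open import Data.Maybe.Base using (Maybe; just; is-just; fromMaybe)
open import Data.Product.Base using (_×_; _,_)
open import Data.Product using (∃!)
open import Data.Sum.Base using (_⊎_)
open import Data.Vec.Base using (tabulate)
open import Data.Vec.Functional using (Vector; transpose)
open import Relation.Binary.PropositionalEquality using (_≡_; _≢_)
open import Relation.Nullary.Negation using (¬_)

-- An m × n array, `nothing` marking an empty cell; the first index is the row.
PartialArray : ℕ → ℕ → Set
PartialArray m n = Vector (Vector (Maybe ℤ) n) m

-- X k = {0, ±1, …, ±(k-1)/2} for k odd and {±1, …, ±k/2} for k even.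
X : ℕ → ℤ → Set
X k x = (¬ (2 ∣ k) × abs x ≤ (k ∸ 1) / 2)
      ⊎ (2 ∣ k × x ≢ 0ℤ × abs x ≤ k / 2)

filled : ∀ {n} → Vector (Maybe ℤ) n → Subset n
filled v = tabulate (λ j → is-just (v j))

lineSum : ∀ {n} → Vector (Maybe ℤ) n → ℤ
lineSum v = sum (λ j → fromMaybe 0ℤ (v j))

record IsSMA (m n s t : ℕ) (A : PartialArray m n) : Set where
  field
    entries∈X     : ∀ i j x → A i j ≡ just x → X (m ℕ.* s) x
    row-filled    : ∀ i → ∣ filled (A i) ∣ ≡ s
    column-filled : ∀ j → ∣ filled (transpose A j) ∣ ≡ t
    exactly-once  : ∀ x → X (m ℕ.* s) x →
                    ∃! {A = Fin m × Fin n} _≡_ (λ (i , j) → A i j ≡ just x)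
    row-sum       : ∀ i → lineSum (A i) ≡ 0ℤ
    column-sum    : ∀ j → lineSum (transpose A j) ≡ 0ℤ

{-# OPTIONS --safe #-}
module Submission where

-- Write t = 2k and label the columns (b , j) with b ∈ {0,1} and j modulo m. The cell in row i and
-- column (b , j) has the offset e ≡ -(i + j) modulo m and is filled iff e < 2k; with e = 2d + p it
-- holds (-1)^(p+b) (2(dm + j) + b + 1). Fixing any one of i, j, e, the other two determine each
-- other. In a column, the entries for p = 0 and p = 1 with the same d are opposite. In a row, the two
-- entries of offset e sum to -1 if p = 0 and to 1 if p = 1, whatever j is.

open import Defs
open import Algebra.Bundles using (CommutativeMonoid)
import Algebra.Properties.CommutativeMonoid.Sum as Sum
open import Data.Bool.Base using (true; false; if_then_else_)
open import Data.Fin.Base using (Fin; zero; suc; toℕ; fromℕ<; combine; remQuot; splitAt; _↑ˡ_; _↑ʳ_)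
open import Data.Fin.Patterns using (0F; 1F)
open import Data.Fin.Permutation using (Permutation′; permutation)
open import Data.Fin.Properties
  using (toℕ-injective; toℕ<n; toℕ-fromℕ<; toℕ-combine; combine-injective; combine-surjective;
         remQuot-combine; combine-remQuot; splitAt-↑ˡ; splitAt-↑ʳ; join-splitAt)
open import Data.Fin.Subset using (∣_∣)
open import Data.Integer.Base as ℤ using (ℤ; 0ℤ; 1ℤ; -1ℤ; _◃_; sign; _⊖_)
  renaming (∣_∣ to abs)
import Data.Integer.Properties as ℤ
open import Data.Maybe.Base using (Maybe; just; nothing; is-just; fromMaybe)
open import Data.Maybe.Properties using (just-injective)
open import Data.Nat.Base using (ℕ; zero; suc; _+_; _*_; _/_; _≤_; _<_)
open import Data.Nat.Divisibility using (_∣_; divides; n∣m*n; ∣m+n∣m⇒∣n; >⇒∤)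
open import Data.Nat.DivMod using (_%_; m%n<n; m≡m%n+[m/n]*n; m*n/n≡m)
import Data.Nat.Properties as ℕ
open import Data.Nat.Tactic.RingSolver using (solve-∀)
open import Data.Product.Base using (∃; ∃₂; _×_; _,_; proj₁; proj₂; uncurry)
open import Data.Product using (∃!)
open import Data.Sign.Base as Sign using (Sign)
open import Data.Sum.Base using (inj₁; inj₂; [_,_]′)
open import Data.Vec.Functional using (Vector; transpose)
open import Function.Base using (_∘_; const)
open import Relation.Binary.PropositionalEquality
  using (_≡_; _≢_; refl; sym; trans; cong; cong₂; subst; subst₂; module ≡-Reasoning)
open import Relation.Nullary.Negation using (contradiction)

-- Residues modulo `n` and triples with sum zero.

residue-unique-≤ : ∀ {n x y} c → x ≤ y → y < n → n ∣ c + x → n ∣ c + y → x ≡ y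
residue-unique-≤ {n} {x} {y} c x≤y y<n n∣c+x n∣c+y with ℕ.m≤n⇒∃[o]m+o≡n x≤y
... | zero  , refl = sym (ℕ.+-identityʳ x)
-- The difference `suc o` would be a multiple of `n`, yet it is positive and at most `y`, hence
-- below `n`.
... | suc o , refl = contradiction
  (∣m+n∣m⇒∣n (subst (n ∣_) (sym (ℕ.+-assoc c x (suc o))) n∣c+y) n∣c+x)
  (>⇒∤ (ℕ.≤-<-trans (ℕ.m≤n+m (suc o) x) y<n))

residue-unique : ∀ {n x y} c → x < n → y < n → n ∣ c + x → n ∣ c + y → x ≡ y
residue-unique {x = x} {y} c x<n y<n n∣c+x n∣c+y with ℕ.≤-total x y
... | inj₁ x≤y = residue-unique-≤ c x≤y y<n n∣c+x n∣c+y
... | inj₂ y≤x = sym (residue-unique-≤ c y≤x x<n n∣c+y n∣c+x)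

-- The residue completing i and j to a triple with sum 0 modulo n.
third : ∀ {n} → Fin n → Fin n → Fin n
third {suc n} i j = fromℕ< (m%n<n ((toℕ i + toℕ j) * n) (suc n))

-- Modulo `suc n` the factor `n` is -1, so the remainder of `s * n` represents -s without any
-- subtraction; the check reduces to `s + s * n ≡ s * suc n`.
third-∣ : ∀ {n} (i j : Fin n) → n ∣ (toℕ i + toℕ j) + toℕ (third i j)
third-∣ {suc n} i j = subst (λ x → suc n ∣ s + x) (sym (toℕ-fromℕ< (m%n<n (s * n) (suc n))))
  (∣m+n∣m⇒∣n (divides s eq) (n∣m*n (s * n / suc n)))
  where
  open ≡-Reasoning
  s = toℕ i + toℕ j
  q = s * n / suc n * suc n
  u = s * n % suc n
  rearrange : ∀ q s u → q + (s + u) ≡ s + (u + q)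
  rearrange = solve-∀
  eq : q + (s + u) ≡ s * suc n
  eq = begin
    q + (s + u)  ≡⟨ rearrange q s u ⟩
    s + (u + q)  ≡⟨ cong (_+_ s) (m≡m%n+[m/n]*n (s * n) (suc n)) ⟨
    s + s * n    ≡⟨ ℕ.*-suc s n ⟨
    s * suc n    ∎

third-comm : ∀ {n} (i j : Fin n) → third i j ≡ third j i
third-comm {suc n} i j rewrite ℕ.+-comm (toℕ i) (toℕ j) = refl

-- Both sides complete `i` and `third i j` to a sum divisible by `n`, and such a residue is unique.
-- This allows any two of row, column residue and offset to serve as coordinates.
third-involutive : ∀ {n} (i j : Fin n) → third i (third i j) ≡ j
third-involutive {n} i j = toℕ-injective
  (residue-unique (toℕ i + toℕ (third i j)) (toℕ<n _) (toℕ<n j) (third-∣ i (third i j))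
    (subst (n ∣_) (swap (toℕ i) (toℕ j) _) (third-∣ i j)))
  where
  swap : ∀ a b c → a + b + c ≡ a + c + b
  swap = solve-∀

third-permutation : ∀ {n} → Fin n → Permutation′ n
third-permutation i = permutation (third i) (third i) (third-involutive i) (third-involutive i)

-- Finite sums in a commutative monoid.

module FinSum {c ℓ} (M : CommutativeMonoid c ℓ) where
  open CommutativeMonoid M using (Carrier; _≈_; _∙_; ε; ∙-congˡ; identityˡ; identityʳ; assoc; setoid)
    renaming (refl to ≈-refl; sym to ≈-sym; trans to ≈-trans)
  open Sum M
  open import Relation.Binary.Reasoning.Setoid setoid

  sum-++ : ∀ m {n} (f : Vector Carrier (m + n)) → sum f ≈ sum (λ i → f (i ↑ˡ n)) ∙ sum (λ j → f (m ↑ʳ j))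
  sum-++ zero    f = ≈-sym (identityˡ _)
  sum-++ (suc m) f = ≈-trans (∙-congˡ (sum-++ m (f ∘ suc))) (≈-sym (assoc _ _ _))

  sum-combine : ∀ m n (f : Vector Carrier (m * n)) →
                sum f ≈ sum {m} (λ i → sum {n} (λ j → f (combine i j)))
  sum-combine zero    n f = ≈-refl
  sum-combine (suc m) n f = ≈-trans (sum-++ n f) (∙-congˡ (sum-combine m n (λ i → f (n ↑ʳ i))))

  sum-≈ε : ∀ {n} (f : Vector Carrier n) → (∀ i → f i ≈ ε) → sum f ≈ ε
  sum-≈ε {n} f f≈ε = ≈-trans (sum-cong-≋ f≈ε) (sum-replicate-zero n)

  -- Meant for sums over offsets: the last `r` belong to empty cells, and the others are written as
  -- block `d` and position `p`.
  sum-supported : ∀ m n {r} (f : Vector Carrier (m * n + r)) → (∀ l → f ((m * n) ↑ʳ l) ≈ ε) →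
                  sum f ≈ sum {m} (λ d → sum {n} (λ p → f (combine d p ↑ˡ r)))
  sum-supported m n {r} f f≈ε = begin
    sum f                                                         ≈⟨ sum-++ (m * n) f ⟩
    sum (λ h → f (h ↑ˡ r)) ∙ sum (λ l → f ((m * n) ↑ʳ l))          ≈⟨ ∙-congˡ (sum-≈ε _ f≈ε) ⟩
    sum (λ h → f (h ↑ˡ r)) ∙ ε                                    ≈⟨ identityʳ _ ⟩
    sum (λ h → f (h ↑ˡ r))                                        ≈⟨ sum-combine m n _ ⟩
    sum {m} (λ d → sum {n} (λ p → f (combine d p ↑ˡ r)))           ∎

module ℕSum = Sum ℕ.+-0-commutativeMonoid
module ℤSum = Sum ℤ.+-0-commutativeMonoid

-- Counting filled cells.

sum-const : ∀ n c → ℕSum.sum {n} (const c) ≡ n * c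
sum-const zero    c = refl
sum-const (suc n) c = cong (_+_ c) (sum-const n c)

occupancy : Maybe ℤ → ℕ
occupancy x = if is-just x then 1 else 0

-- As a monoid sum, the count can be rearranged by the same argument as the sum of the entries.
∣filled∣≡sum : ∀ {n} (v : Vector (Maybe ℤ) n) → ∣ filled v ∣ ≡ ℕSum.sum (occupancy ∘ v)
∣filled∣≡sum {zero}  v = refl
∣filled∣≡sum {suc n} v with is-just (v zero)
... | true  = cong suc (∣filled∣≡sum (v ∘ suc))
... | false = ∣filled∣≡sum (v ∘ suc)

-- The two values of `b` give consecutive absolute values, which is why the pairs in a row sum to -1
-- or 1.
toℕ-combine-1F : ∀ {n} (i : Fin n) → toℕ (combine {n = 2} i 1F) ≡ suc (toℕ (combine {n = 2} i 0F))
toℕ-combine-1F i = begin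
  toℕ (combine {n = 2} i 1F)          ≡⟨ toℕ-combine i 1F ⟩
  2 * toℕ i + 1               ≡⟨ ℕ.+-suc (2 * toℕ i) 0 ⟩
  suc (2 * toℕ i + 0)         ≡⟨ cong suc (toℕ-combine {n = 2} i 0F) ⟨
  suc (toℕ (combine {n = 2} i 0F))    ∎
  where open ≡-Reasoning

entrySign : Fin 2 → Fin 2 → Sign
entrySign 0F 0F = Sign.+
entrySign 0F 1F = Sign.-
entrySign 1F 0F = Sign.-
entrySign 1F 1F = Sign.+

-- For fixed `b` the sign and `p` determine each other, so `p` can be read off an entry once `b` is
-- known from its absolute value.
entrySign-injectiveˡ : ∀ p q b → entrySign p b ≡ entrySign q b → p ≡ q
entrySign-injectiveˡ 0F 0F _  _ = refl
entrySign-injectiveˡ 1F 1F _  _ = refl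
entrySign-injectiveˡ 0F 1F 0F ()
entrySign-injectiveˡ 0F 1F 1F ()
entrySign-injectiveˡ 1F 0F 0F ()
entrySign-injectiveˡ 1F 0F 1F ()

entrySign-surjectiveˡ : ∀ b s → ∃ λ p → entrySign p b ≡ s
entrySign-surjectiveˡ 0F Sign.+ = 0F , refl
entrySign-surjectiveˡ 0F Sign.- = 1F , refl
entrySign-surjectiveˡ 1F Sign.+ = 1F , refl
entrySign-surjectiveˡ 1F Sign.- = 0F , refl

n⊖1+n : ∀ n → n ⊖ suc n ≡ -1ℤ
n⊖1+n zero    = refl
n⊖1+n (suc n) = trans (ℤ.[1+m]⊖[1+n]≡m⊖n n (suc n)) (n⊖1+n n)

1+n⊖n : ∀ n → suc n ⊖ n ≡ 1ℤ
1+n⊖n zero    = refl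
1+n⊖n (suc n) = trans (ℤ.[1+m]⊖[1+n]≡m⊖n (suc n) n) (1+n⊖n n)

-- The array and its cells.

module Construction (k r : ℕ) where

  m : ℕ
  m = k * 2 + r

  -- The nested `combine` is a mixed-radix numeral with digits `d`, `j`, `b`, so the absolute values
  -- run once through 1, ..., 2km for each `p`; `suc` skips 0.
  entry : Fin k → Fin 2 → Fin 2 → Fin m → ℤ
  entry d p b j = entrySign p b ◃ suc (toℕ (combine (combine d j) b))

  cell : Fin m → Fin 2 → Fin m → Maybe ℤ
  cell e b j = [ (λ h → just (uncurry entry (remQuot 2 h) b j)) , const nothing ]′ (splitAt (k * 2) e)

  array : PartialArray m (2 * m)
  array i c = uncurry (λ b j → cell (third i j) b j) (remQuot {2} m c)

  cell-↑ˡ : ∀ d p b j → cell (combine d p ↑ˡ r) b j ≡ just (entry d p b j)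
  cell-↑ˡ d p b j rewrite splitAt-↑ˡ (k * 2) (combine d p) r =
    cong (λ (d , p) → just (entry d p b j)) (remQuot-combine d p)

  cell-↑ʳ : ∀ l b j → cell ((k * 2) ↑ʳ l) b j ≡ nothing
  cell-↑ʳ l b j rewrite splitAt-↑ʳ (k * 2) r l = refl

  cell-just : ∀ e b j {x} → cell e b j ≡ just x →
              ∃₂ λ d p → e ≡ combine d p ↑ˡ r × entry d p b j ≡ x
  cell-just e b j eq with splitAt (k * 2) e | join-splitAt (k * 2) r e
  ... | inj₁ h | refl = proj₁ (remQuot {k} 2 h) , proj₂ (remQuot {k} 2 h) ,
                        cong (_↑ˡ r) (sym (combine-remQuot {k} 2 h)) , just-injective eq
  cell-just e b j () | inj₂ l | _

  array-combine : ∀ i b j → array i (combine b j) ≡ cell (third i j) b j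
  array-combine i b j = cong (uncurry (λ b j → cell (third i j) b j)) (remQuot-combine {2} b j)

  -- Each element of `X` occurs exactly once.

  entry-injective : ∀ d p b j d′ p′ b′ j′ → entry d p b j ≡ entry d′ p′ b′ j′ →
                    d ≡ d′ × p ≡ p′ × b ≡ b′ × j ≡ j′
  entry-injective d p b j d′ p′ b′ j′ eq
    with combine-injective (combine d j) b (combine d′ j′) b′
           (toℕ-injective (ℕ.suc-injective (ℤ.abs-cong eq)))
  -- The digit `b` has to be identified before the signs are compared: only for equal `b` do equal
  -- signs force equal `p`.
  ... | dj≡dj′ , refl with combine-injective d j d′ j′ dj≡dj′
  ... | refl , refl = refl , entrySign-injectiveˡ p p′ b (ℤ.sign-cong eq) , refl , refl

  abs-entry : ∀ d p b j → abs (entry d p b j) ≡ suc (toℕ (combine (combine d j) b))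
  abs-entry d p b j = ℤ.abs-◃ (entrySign p b) _

  -- The digits of `abs x` minus one supply `d`, `j`, `b`; the sign of `x` then supplies `p`.
  entry-surjective : ∀ x → x ≢ 0ℤ → abs x ≤ k * m * 2 →
                     ∃₂ λ d p → ∃₂ λ b j → entry d p b j ≡ x
  entry-surjective x x≢0 x≤ with abs x in eq
  ... | zero  = contradiction (ℤ.∣i∣≡0⇒i≡0 eq) x≢0
  ... | suc n with combine-surjective {k * m} {2} (fromℕ< x≤)
  ... | dj , b , dj,b≡n with combine-surjective {k} {m} dj | entrySign-surjectiveˡ b (sign x)
  ... | d , j , refl | p , sign≡ = d , p , b , j , (begin
    entrySign p b ◃ suc (toℕ (combine (combine d j) b))  ≡⟨ cong₂ _◃_ sign≡ (cong (suc ∘ toℕ) dj,b≡n) ⟩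
    sign x ◃ suc (toℕ (fromℕ< x≤))                       ≡⟨ cong (λ n → sign x ◃ suc n) (toℕ-fromℕ< x≤) ⟩
    sign x ◃ suc n                                       ≡⟨ cong (sign x ◃_) eq ⟨
    sign x ◃ abs x                                       ≡⟨ ℤ.◃-inverse x ⟩
    x                                                    ∎)
    where open ≡-Reasoning

  -- Shows that the number of filled cells is even with half `k * m * 2`, so the even case of `X`
  -- applies with exactly the bound on the entries.
  size : m * (2 * (k * 2)) ≡ k * m * 2 * 2
  size = size′ m k
    where
    size′ : ∀ m k → m * (2 * (k * 2)) ≡ k * m * 2 * 2
    size′ = solve-∀

  X⇒bounded : ∀ x → X (m * (2 * (k * 2))) x → x ≢ 0ℤ × abs x ≤ k * m * 2
  X⇒bounded x x∈X with m * (2 * (k * 2)) | size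
  X⇒bounded x (inj₁ (odd , _)) | _ | refl = contradiction (n∣m*n (k * m * 2)) odd
  X⇒bounded x (inj₂ (_ , x≢0 , x≤)) | _ | refl = x≢0 , subst (abs x ≤_) (m*n/n≡m (k * m * 2) 2) x≤

  entry∈X : ∀ d p b j → X (m * (2 * (k * 2))) (entry d p b j)
  entry∈X d p b j with m * (2 * (k * 2)) | size
  ... | _ | refl = inj₂ (n∣m*n (k * m * 2) , nonzero ,
    subst₂ _≤_ (sym (abs-entry d p b j)) (sym (m*n/n≡m (k * m * 2) 2)) (toℕ<n _))
    where
    nonzero : entry d p b j ≢ 0ℤ
    nonzero eq = ℕ.1+n≢0 (trans (sym (abs-entry d p b j)) (cong abs eq))

  -- The row is recovered from the column residue and the offset, since `third j` undoes itself.
  array-just : ∀ i c {x} → array i c ≡ just x → ∃₂ λ d p → ∃₂ λ b j →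
               i ≡ third j (combine d p ↑ˡ r) × c ≡ combine b j × entry d p b j ≡ x
  array-just i c eq with combine-surjective {2} {m} c
  ... | b , j , refl with cell-just (third i j) b j (trans (sym (array-combine i b j)) eq)
  ... | d , p , e≡ , entry≡ = d , p , b , j ,
    trans (sym (third-involutive j i)) (cong (third j) (trans (third-comm j i) e≡)) , refl , entry≡

  array-entry : ∀ d p b j → array (third j (combine d p ↑ˡ r)) (combine b j) ≡ just (entry d p b j)
  array-entry d p b j = begin
    array (third j e) (combine b j)  ≡⟨ array-combine (third j e) b j ⟩
    cell (third (third j e) j) b j   ≡⟨ cong (λ e → cell e b j) (third-comm (third j e) j) ⟩
    cell (third j (third j e)) b j   ≡⟨ cong (λ e → cell e b j) (third-involutive j e) ⟩
    cell e b j                       ≡⟨ cell-↑ˡ d p b j ⟩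
    just (entry d p b j)             ∎
    where
    open ≡-Reasoning
    e = combine d p ↑ˡ r

  array-∃! : ∀ x → X (m * (2 * (k * 2))) x →
             ∃! {A = Fin m × Fin (2 * m)} _≡_ (λ (i , c) → array i c ≡ just x)
  array-∃! x x∈X with uncurry (entry-surjective x) (X⇒bounded x x∈X)
  ... | d , p , b , j , refl = (_ , _) , array-entry d p b j , unique
    where
    unique : ∀ {ic} → uncurry array ic ≡ just (entry d p b j) →
             (third j (combine d p ↑ˡ r) , combine b j) ≡ ic
    unique {i , c} eq with array-just i c eq
    ... | d′ , p′ , b′ , j′ , refl , refl , entry≡
      with entry-injective d′ p′ b′ j′ d p b j entry≡
    ... | refl , refl , refl , refl = refl

  array∈X : ∀ i c x → array i c ≡ just x → X (m * (2 * (k * 2))) x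
  array∈X i c x eq with array-just i c eq
  ... | d , p , b , j , _ , _ , refl = entry∈X d p b j

  -- Sums along rows and columns, for counts and entries alike.

  module Line {c ℓ} (M : CommutativeMonoid c ℓ) (w : Maybe ℤ → CommutativeMonoid.Carrier M)
              (w-nothing : CommutativeMonoid._≈_ M (w nothing) (CommutativeMonoid.ε M)) where
    open CommutativeMonoid M using (Carrier; _≈_; ε; setoid; reflexive) renaming (trans to ≈-trans)
    open Sum M
    open FinSum M
    open import Relation.Binary.Reasoning.Setoid setoid

    -- Rewrites the row in terms of offsets: empty ones contribute the neutral element, and `k`
    -- blocks of four cells remain.
    row : ∀ i → sum (λ c → w (array i c)) ≈
          sum {k} (λ d → sum {2} (λ p → sum {2} (λ b →
            w (just (entry d p b (third i (combine d p ↑ˡ r)))))))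
    row i = begin
      sum (λ c → w (array i c))
        ≈⟨ sum-combine 2 m _ ⟩
      sum {2} (λ b → sum {m} (λ j → w (array i (combine b j))))
        ≡⟨ sum-cong-≗ {2} (λ b → sum-cong-≗ (λ j → cong w (array-combine i b j))) ⟩
      sum {2} (λ b → sum (λ j → w (cell (third i j) b j)))
        -- With `j` outermost, the two cells sharing an offset stand together and the substitution
        -- of `third i e` for `j` moves both at once.
        ≈⟨ ∑-comm {2} {m} (λ b j → w (cell (third i j) b j)) ⟩
      sum (λ j → sum {2} (λ b → w (cell (third i j) b j)))
        ≈⟨ sum-permute _ (third-permutation i) ⟩
      sum (λ e → sum {2} (λ b → w (cell (third i (third i e)) b (third i e))))
        ≡⟨ sum-cong-≗ (λ e → sum-cong-≗ {2} (λ b →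
             cong (λ e′ → w (cell e′ b (third i e))) (third-involutive i e))) ⟩
      sum (λ e → sum {2} (λ b → w (cell e b (third i e))))
        ≈⟨ sum-supported k 2 _ (λ l → sum-≈ε {2} _ (λ b →
             ≈-trans (reflexive (cong w (cell-↑ʳ l b (third i ((k * 2) ↑ʳ l))))) w-nothing)) ⟩
      sum {k} (λ d → sum {2} (λ p → sum {2} (λ b →
        w (cell (combine d p ↑ˡ r) b (third i (combine d p ↑ˡ r))))))
        ≡⟨ sum-cong-≗ {k} (λ d → sum-cong-≗ {2} (λ p → sum-cong-≗ {2} (λ b →
             cong w (cell-↑ˡ d p b (third i (combine d p ↑ˡ r)))))) ⟩
      sum {k} (λ d → sum {2} (λ p → sum {2} (λ b →
        w (just (entry d p b (third i (combine d p ↑ˡ r)))))))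
        ∎

    -- With `b` and `j` fixed, the offset runs through all residues as the row does, which leaves
    -- `k` pairs of cells.
    column : ∀ b j → sum (λ i → w (array i (combine b j))) ≈
             sum {k} (λ d → sum {2} (λ p → w (just (entry d p b j))))
    column b j = begin
      sum (λ i → w (array i (combine b j)))
        ≡⟨ sum-cong-≗ (λ i → cong w (trans (array-combine i b j)
             (cong (λ e → cell e b j) (third-comm i j)))) ⟩
      sum (λ i → w (cell (third j i) b j))
        ≈⟨ sum-permute _ (third-permutation j) ⟩
      sum (λ e → w (cell (third j (third j e)) b j))
        ≡⟨ sum-cong-≗ (λ e → cong (λ e → w (cell e b j)) (third-involutive j e)) ⟩
      sum (λ e → w (cell e b j))
        ≈⟨ sum-supported k 2 _ (λ l → ≈-trans (reflexive (cong w (cell-↑ʳ l b j))) w-nothing) ⟩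
      sum {k} (λ d → sum {2} (λ p → w (cell (combine d p ↑ˡ r) b j)))
        ≡⟨ sum-cong-≗ {k} (λ d → sum-cong-≗ {2} (λ p → cong w (cell-↑ˡ d p b j))) ⟩
      sum {k} (λ d → sum {2} (λ p → w (just (entry d p b j))))
        ∎

  module Count = Line ℕ.+-0-commutativeMonoid occupancy refl
  module Total = Line ℤ.+-0-commutativeMonoid (fromMaybe 0ℤ) refl

  -- Cancellation inside blocks.

  entry-pair-row₀ : ∀ d j → ℤSum.sum {2} (λ b → entry d 0F b j) ≡ -1ℤ
  entry-pair-row₀ d j = begin
    ℤSum.sum {2} (λ b → entry d 0F b j)
      ≡⟨ cong (ℤ._+_ (entry d 0F 0F j)) (ℤ.+-identityʳ (entry d 0F 1F j)) ⟩
    entry d 0F 0F j ℤ.+ entry d 0F 1F j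
      -- The signs are + for `b` = 0 and - for `b` = 1, so the sum computes to a difference of two
      -- consecutive naturals.
      ≡⟨ cong (λ n → suc n₀ ⊖ suc n) (toℕ-combine-1F (combine d j)) ⟩
    suc n₀ ⊖ suc (suc n₀)
      ≡⟨ n⊖1+n (suc n₀) ⟩
    -1ℤ
      ∎
    where
    open ≡-Reasoning
    n₀ = toℕ (combine {n = 2} (combine d j) 0F)

  entry-pair-row₁ : ∀ d j → ℤSum.sum {2} (λ b → entry d 1F b j) ≡ 1ℤ
  entry-pair-row₁ d j = begin
    ℤSum.sum {2} (λ b → entry d 1F b j)
      ≡⟨ cong (ℤ._+_ (entry d 1F 0F j)) (ℤ.+-identityʳ (entry d 1F 1F j)) ⟩
    entry d 1F 0F j ℤ.+ entry d 1F 1F j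
      ≡⟨ cong (λ n → suc n ⊖ suc n₀) (toℕ-combine-1F (combine d j)) ⟩
    suc (suc n₀) ⊖ suc n₀
      ≡⟨ 1+n⊖n (suc n₀) ⟩
    1ℤ
      ∎
    where
    open ≡-Reasoning
    n₀ = toℕ (combine {n = 2} (combine d j) 0F)

  -- The two offsets of a block meet the row at different column residues, so `j` depends on `p`.
  -- The pair sums -1 and 1 are the same for every residue and still cancel.
  entry-block-row : ∀ d (j : Fin 2 → Fin m) →
                    ℤSum.sum {2} (λ p → ℤSum.sum {2} (λ b → entry d p b (j p))) ≡ 0ℤ
  entry-block-row d j =
    cong₂ (λ x y → x ℤ.+ (y ℤ.+ 0ℤ)) (entry-pair-row₀ d (j 0F)) (entry-pair-row₁ d (j 1F))

  entry-pair-column : ∀ d b j → ℤSum.sum {2} (λ p → entry d p b j) ≡ 0ℤ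
  entry-pair-column d b j =
    trans (cong (ℤ._+_ (entry d 0F b j)) (ℤ.+-identityʳ (entry d 1F b j))) (cancel b)
    where
    cancel : ∀ b → entry d 0F b j ℤ.+ entry d 1F b j ≡ 0ℤ
    -- Once `b` is known, the second entry evaluates to the negative of the first.
    cancel 0F = ℤ.+-inverseʳ (entry d 0F 0F j)
    cancel 1F = ℤ.+-inverseʳ (entry d 0F 1F j)

  isSMA : IsSMA m (2 * m) (2 * (k * 2)) (k * 2) array
  isSMA = record
    { entries∈X     = array∈X
    -- A block fills four cells of a row, two offsets for each of two values of `b`, but only two
    -- cells of a column.
    ; row-filled    = λ i → trans (∣filled∣≡sum (array i))
                       (trans (Count.row i) (trans (sum-const k 4) (k*4 k)))
    ; column-filled = λ c → trans (∣filled∣≡sum (transpose array c))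
                       (byColumn (λ c → ℕSum.sum (λ i → occupancy (array i c)) ≡ k * 2)
                         (λ b j → trans (Count.column b j) (sum-const k 2)) c)
    ; exactly-once  = array-∃!
    ; row-sum       = λ i → trans (Total.row i)
                       (sum-≈ε _ (λ d → entry-block-row d (λ p → third i (combine d p ↑ˡ r))))
    ; column-sum    = byColumn (λ c → lineSum (transpose array c) ≡ 0ℤ)
                       (λ b j → trans (Total.column b j)
                         (sum-≈ε _ (λ d → entry-pair-column d b j)))
    }
    where
    open FinSum ℤ.+-0-commutativeMonoid using (sum-≈ε)
    k*4 : ∀ k → k * 4 ≡ 2 * (k * 2)
    k*4 = solve-∀
    byColumn : (P : Fin (2 * m) → Set) → (∀ b j → P (combine b j)) → ∀ c → P c
    byColumn P p c with combine-surjective {2} {m} c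
    ... | b , j , refl = p b j

theorem12 : ∀ (m t : ℕ) → 3 ≤ t → t ≤ m → 2 ∣ t → ∃ (λ (A : PartialArray m (2 * m)) → IsSMA m (2 * m) (2 * t) t A)
theorem12 m t _ t≤m (divides k refl) with ℕ.m≤n⇒∃[o]m+o≡n t≤m
-- Here `t` is `k * 2` and `m` is `k * 2 + r`, so `r` is the number of empty cells in each column.
... | r , refl = array , isSMA
  where open Construction k r
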